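{- Let $(X,\phi)$ be an acyclic convex geometry. Then $(X,\phi)$ is ranked if and only if its critical base is ranked.
   Context: All sets are finite. A closure operator $\phi$ on $X$ is extensive, monotone and idempotent on $2^X$. $(X,\phi)$ is standard if $\phi(\emptyset)=\emptyset$ and $\phi(\{x\})\setminus\{x\}$ is closed for each $x$. A unit implicational base $\Sigma$ (set of implications $A\to b$, $A\subseteq X$, $b\in X$) is an implicational base of $(X,\phi)$ if its closed sets (sets $S$ such that for each $A\to b\in\Sigma$, $A\not\subseteq S$ or $b\in S$) are exactly the closed sets of $\phi$. $\Sigma$ is acyclic if the directed graph on $X$ with arcs $x\to y$ whenever some $A\to y\in\Sigma$ has $x\in A$ has no directed cycle; irredundant if removing any implication changes the closed sets. An acyclic convex geometry is a standard closure space admitting an acyclic implicational base. $A$ is a minimal generator of $b$ if $b\in\phi(A)$ and $b\notin\phi(A\setminus\{x\})$ for all $x\in A$. An acyclic convex geometry admits a unique irredundant implicational base all of whose implications $A\to b$ have $A$ a minimal generator of $b$; it is called the critical base. A rank function on $\Sigma$ is a map $\rho:X\to\mathbb{N}$ such that $\rho(a)=\rho(b)+1$ whenever $A\to b\in\Sigma$ and $a\in A$; $\Sigma$ is ranked if it admits a rank function. A convex geometry is ranked if it admits a ranked implicational base. -}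

module Defs where

open import Data.Bool.Properties using () renaming (_≟_ to _≟ᵇ_)
open import Data.Fin using (Fin)
open import Data.Fin.Properties using () renaming (_≟_ to _≟ᶠ_)
open import Data.Fin.Subset using (Subset; _∈_; _∉_; _⊆_; _⊈_; _-_; ⊥; ⁅_⁆)
open import Data.List using (List; filter)
open import Data.List.Membership.Propositional using () renaming (_∈_ to _∈ˡ_)
open import Data.Nat using (ℕ; _+_)
open import Data.Product using (_×_; _,_; ∃-syntax)
open import Data.Product.Properties using (≡-dec)
open import Data.Sum using (_⊎_)
import Data.Vec.Properties as Vec
open import Function.Bundles using (_⇔_)
open import Relation.Binary.Construct.Closure.Transitive using (TransClosure)
open import Relation.Binary.Definitions using (DecidableEquality)
open import Relation.Binary.PropositionalEquality using (_≡_)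
open import Relation.Nullary using (¬_; ¬?)

private
  variable
    n : ℕ

record ClosureSpace (n : ℕ) : Set where
  field
    φ          : Subset n → Subset n
    extensive  : ∀ S → S ⊆ φ S
    monotone   : ∀ {S T} → S ⊆ T → φ S ⊆ φ T
    idempotent : ∀ S → φ (φ S) ≡ φ S

  IsClosed : Subset n → Set
  IsClosed S = φ S ≡ S

  record IsStandard : Set where
    field
      ∅-closed      : φ ⊥ ≡ ⊥
      φ⁅x⁆-x-closed : ∀ x → IsClosed (φ ⁅ x ⁆ - x)

  IsMinimalGenerator : Subset n → Fin n → Set
  IsMinimalGenerator A b = b ∈ φ A × (∀ {x} → x ∈ A → b ∉ φ (A - x))

-- (A , b) stands for A → b.
Implication : ℕ → Set
Implication n = Subset n × Fin n

_≟ⁱ_ : DecidableEquality (Implication n)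
_≟ⁱ_ = ≡-dec (Vec.≡-dec _≟ᵇ_) _≟ᶠ_

-- A list represents the finite set of its members: every notion below is
-- insensitive to order and multiplicity.
Implications : ℕ → Set
Implications n = List (Implication n)

-- All copies of i are dropped, as required when a list represents a set.
_∖_ : Implications n → Implication n → Implications n
Σ ∖ i = filter (λ j → ¬? (j ≟ⁱ i)) Σ

Satisfies : Implications n → Subset n → Set
Satisfies Σ S = ∀ {A b} → (A , b) ∈ˡ Σ → A ⊈ S ⊎ b ∈ S

Arc : Implications n → Fin n → Fin n → Set
Arc Σ x y = ∃[ A ] (A , y) ∈ˡ Σ × x ∈ A

-- Loops x → x count as directed cycles.
Acyclic : Implications n → Set
Acyclic Σ = ∀ x → ¬ TransClosure (Arc Σ) x x

Irredundant : Implications n → Set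
Irredundant Σ = ∀ {i} → i ∈ˡ Σ → ¬ (∀ S → Satisfies (Σ ∖ i) S ⇔ Satisfies Σ S)

IsRankFunction : Implications n → (Fin n → ℕ) → Set
IsRankFunction Σ ρ = ∀ {A a b} → (A , b) ∈ˡ Σ → a ∈ A → ρ a ≡ ρ b + 1

Ranked : Implications n → Set
Ranked Σ = ∃[ ρ ] IsRankFunction Σ ρ

module _ (X : ClosureSpace n) where
  open ClosureSpace X

  IsImplicationalBase : Implications n → Set
  IsImplicationalBase Σ = ∀ S → Satisfies Σ S ⇔ IsClosed S

  record IsAcyclicConvexGeometry : Set where
    field
      isStandard  : IsStandard
      acyclicBase : ∃[ Σ ] IsImplicationalBase Σ × Acyclic Σ

  -- In an acyclic convex geometry exactly one set of implications is a
  -- critical base.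
  record IsCriticalBase (Σ : Implications n) : Set where
    field
      isBase            : IsImplicationalBase Σ
      irredundant       : Irredundant Σ
      minimalGenerators : ∀ {A b} → (A , b) ∈ˡ Σ → IsMinimalGenerator A b

  IsRankedGeometry : Set
  IsRankedGeometry = ∃[ Σ ] IsImplicationalBase Σ × Ranked Σ

{-# OPTIONS --safe #-}

-- Let ρ be a rank function of a base Σ.  An element x ∉ S of φ S already lies in
-- φ of the elements of S of rank > ρ x.  Hence the premises of a critical
-- implication A → b rank above b, and ρ is a rank function of the critical base as
-- soon as each a ∈ A belongs to some A' with A' → b in Σ.  Otherwise, for every
-- A' → b in Σ the elements of A' have rank ρ b + 1 ≤ ρ a, so a ∉ φ A', and b is
-- derived from A' without using A → b.  Elements ranked above b are derived from A
-- without A → b too, so A → b would be redundant.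
module Submission where

open import Defs
open import Data.Empty using (⊥-elim)
open import Data.Nat using (ℕ; _+_; _≤_; _<_; _≤?_; _<?_; z<s)
open import Data.Nat.Properties
  using (m<m+n; ≤-refl; ≤-reflexive; ≤-trans; ≤-<-trans; <-≤-trans; <-irrefl; <⇒≤;
         ≰⇒>; ≮⇒≥; +-comm)
  renaming (_≟_ to _≟ⁿ_)
open import Data.Fin using (Fin)
open import Data.Fin.Properties using () renaming (_≟_ to _≟ᶠ_)
open import Data.Fin.Subset using (Subset; _∈_; _∉_; _⊆_; _∪_; _∩_; _-_; ⊥)
open import Data.Fin.Subset.Properties
  using (_⊆?_; ∉⊥; p⊆p∪q; x∈p∪q⁻; x∈p∪q⁺; x∈p∩q⁻; x∈p∩q⁺;
         p∩q⊆p; p∩q⊆q; x∈p∧x≢y⇒x∈p-y)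
open import Data.List.Membership.Propositional using () renaming (_∈_ to _∈ˡ_)
open import Data.List.Membership.Propositional.Properties using (∈-filter⁺; ∈-filter⁻)
open import Data.Product using (_×_; _,_; proj₁; proj₂)
open import Data.Sum using (inj₁; inj₂; fromInj₁)
open import Data.Vec using (tabulate)
open import Data.Vec.Properties using (lookup∘tabulate; lookup⇒[]=; []=⇒lookup)
open import Function using (_∘_)
open import Function.Bundles using (_⇔_; mk⇔; Equivalence)
open import Level using (0ℓ)
open import Relation.Binary.PropositionalEquality using (_≡_; _≢_; refl; sym; trans; subst)
open import Relation.Nullary
  using (¬_; ¬?; yes; no; does; contradiction; _×-dec_)
open import Relation.Nullary.Decidable using (decidable-stable; dec-true)
open import Relation.Unary using (Pred; Decidable)

private
  variable
    n : ℕ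

module _ {P : Pred (Fin n) 0ℓ} (P? : Decidable P) where

  comprehension : Subset n
  comprehension = tabulate (does ∘ P?)

  ∈-comprehension⁺ : ∀ {x} → P x → x ∈ comprehension
  ∈-comprehension⁺ {x} Px =
    lookup⇒[]= x _ (trans (lookup∘tabulate (does ∘ P?) x) (dec-true (P? x) Px))

  ∈-comprehension⁻ : ∀ {x} → x ∈ comprehension → P x
  ∈-comprehension⁻ {x} x∈ with P? x | trans (sym (lookup∘tabulate (does ∘ P?) x)) ([]=⇒lookup x∈)
  ... | yes Px | _ = Px
  ... | no _   | ()

module _ (Σ : Implications n) (S : Subset n) where

  satisfies⁺ : (∀ {A b} → (A , b) ∈ˡ Σ → A ⊆ S → b ∈ S) → Satisfies Σ S
  satisfies⁺ h {A} A→b with A ⊆? S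
  ... | yes A⊆S = inj₂ (h A→b A⊆S)
  ... | no  A⊈S = inj₁ A⊈S

  satisfies⁻ : Satisfies Σ S → ∀ {A b} → (A , b) ∈ˡ Σ → A ⊆ S → b ∈ S
  satisfies⁻ sat A→b A⊆S with sat A→b
  ... | inj₁ A⊈S = ⊥-elim (A⊈S A⊆S)
  ... | inj₂ b∈S = b∈S

∩-satisfies : ∀ (Σ : Implications n) S T → Satisfies Σ S → Satisfies Σ T → Satisfies Σ (S ∩ T)
∩-satisfies Σ S T satS satT = satisfies⁺ Σ (S ∩ T) λ A→b A⊆S∩T →
  x∈p∩q⁺ ( satisfies⁻ Σ S satS A→b (p∩q⊆p S T ∘ A⊆S∩T)
         , satisfies⁻ Σ T satT A→b (p∩q⊆q S T ∘ A⊆S∩T) )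

module _ (Σ : Implications n) (i : Implication n) (S : Subset n) where

  ∖-satisfies : Satisfies Σ S → Satisfies (Σ ∖ i) S
  ∖-satisfies sat j∈ = sat (proj₁ (∈-filter⁻ (λ j → ¬? (j ≟ⁱ i)) j∈))

  ∖-satisfies⁻ : Satisfies (Σ ∖ i) S → (proj₁ i ⊆ S → proj₂ i ∈ S) → Satisfies Σ S
  ∖-satisfies⁻ sat h = satisfies⁺ Σ S go
    where
    go : ∀ {A b} → (A , b) ∈ˡ Σ → A ⊆ S → b ∈ S
    go {A} {b} A→b A⊆S with (A , b) ≟ⁱ i
    ... | yes refl = h A⊆S
    ... | no  ≢i   = satisfies⁻ (Σ ∖ i) S sat (∈-filter⁺ (λ j → ¬? (j ≟ⁱ i)) A→b ≢i) A⊆S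

-- If every set that satisfies the other implications and contains `A` also contains `b`, then
-- dropping `A → b` changes no closed set.
irredundant-essential : ∀ {Σ : Implications n} → Irredundant Σ → ∀ {A b} → (A , b) ∈ˡ Σ →
                        ¬ (∀ S → Satisfies (Σ ∖ (A , b)) S → A ⊆ S → b ∈ S)
irredundant-essential {Σ = Σ} irr {A} {b} A→b h = irr A→b λ S →
  mk⇔ {A = Satisfies (Σ ∖ (A , b)) S} {B = Satisfies Σ S}
      (λ sat → ∖-satisfies⁻ Σ (A , b) S sat (h S sat))
      (∖-satisfies Σ (A , b) S)

irredundant⇒b∉A : ∀ {Σ : Implications n} → Irredundant Σ → ∀ {A b} → (A , b) ∈ˡ Σ → b ∉ A
irredundant⇒b∉A irr A→b b∈A = irredundant-essential irr A→b λ _ _ A⊆S → A⊆S b∈A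

-- Implications concluding in `P` hold because their conclusion is added. By the first hypothesis
-- the others have no premise in `P`, so the added elements cannot trigger them and only `S`
-- matters.
∪-comprehension-satisfies :
  ∀ {Σ : Implications n} {P : Pred (Fin n) 0ℓ} (P? : Decidable P) {S} →
  (∀ {B c x} → (B , c) ∈ˡ Σ → ¬ P c → x ∈ B → ¬ P x) →
  (∀ {B c} → (B , c) ∈ˡ Σ → ¬ P c → B ⊆ S → c ∈ S) →
  Satisfies Σ (S ∪ comprehension P?)
∪-comprehension-satisfies {Σ = Σ} P? {S} up sat = satisfies⁺ Σ _ go
  where
  go : ∀ {B c} → (B , c) ∈ˡ Σ → B ⊆ S ∪ comprehension P? → c ∈ S ∪ comprehension P?
  go {B} {c} B→c B⊆ with P? c
  ... | yes Pc = x∈p∪q⁺ (inj₂ (∈-comprehension⁺ P? Pc))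
  ... | no ¬Pc = x∈p∪q⁺ (inj₁ (sat B→c ¬Pc λ x∈B →
    fromInj₁ (λ x∈P → contradiction (∈-comprehension⁻ P? x∈P) (up B→c ¬Pc x∈B))
             (x∈p∪q⁻ S _ (B⊆ x∈B))))

module _ (ρ : Fin n → ℕ) (b : Fin n) where

  Above : Pred (Fin n) 0ℓ
  Above x = ρ b < ρ x

  above? : Decidable Above
  above? x = ρ b <? ρ x

  -- `b` is left out so that the union of this set with some `T` contains `b` only if `T` does.
  AtMostExcept : Pred (Fin n) 0ℓ
  AtMostExcept x = ρ x ≤ ρ b × x ≢ b

  atMostExcept? : Decidable AtMostExcept
  atMostExcept? x = (ρ x ≤? ρ b) ×-dec ¬? (x ≟ᶠ b)

  ∉atMostExcept⇒≤ : ∀ {x} → ¬ AtMostExcept x → ρ b ≤ ρ x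
  ∉atMostExcept⇒≤ {x} ¬P with x ≟ᶠ b
  ... | yes refl = ≤-refl
  ... | no x≢b   = <⇒≤ (≰⇒> λ x≤b → ¬P (x≤b , x≢b))

module _ {Σ : Implications n} {ρ : Fin n → ℕ} (rank : IsRankFunction Σ ρ) where

  rank-< : ∀ {A b a} → (A , b) ∈ˡ Σ → a ∈ A → ρ b < ρ a
  rank-< {b = b} A→b a∈A = subst (ρ b <_) (sym (rank A→b a∈A)) (m<m+n (ρ b) z<s)

  -- The gap at `b` does no harm: the premises of an implication concluding `b` rank strictly above
  -- `b`, so they are not low either.
  premise-∉atMostExcept : ∀ b {B c x} → (B , c) ∈ˡ Σ → ¬ AtMostExcept ρ b c →
                          x ∈ B → ¬ AtMostExcept ρ b x
  premise-∉atMostExcept b B→c c∉ x∈B (x≤b , _) = <-irrefl refl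
    (≤-<-trans (∉atMostExcept⇒≤ ρ b c∉) (<-≤-trans (rank-< B→c x∈B) x≤b))

module _ (X : ClosureSpace n) where
  open ClosureSpace X

  φ-closed : ∀ S → IsClosed (φ S)
  φ-closed = idempotent

  satisfies⇒closed : ∀ {Σ} → IsImplicationalBase X Σ → ∀ S → Satisfies Σ S → IsClosed S
  satisfies⇒closed base S = Equivalence.to (base S)

  φ-satisfies : ∀ {Σ} → IsImplicationalBase X Σ → ∀ S → Satisfies Σ (φ S)
  φ-satisfies base S = Equivalence.from (base (φ S)) (φ-closed S)

  φ-least : ∀ {S T} → IsClosed T → S ⊆ T → φ S ⊆ T
  φ-least closed S⊆T x∈φS = subst (_ ∈_) closed (monotone S⊆T x∈φS)

  module _ {Σ : Implications n} {ρ : Fin n → ℕ}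
           (base : IsImplicationalBase X Σ) (rank : IsRankFunction Σ ρ) where

    -- `W` is closed and contains `S`: elements of `S` above `x` lie in `T`, the rest differ from
    -- `x` and are low. So `x` is in `W`, and not being low it is in `T`.
    ∈φ⇒∈φ-above : ∀ {S x} → x ∉ S → x ∈ φ S → x ∈ φ (S ∩ comprehension (above? ρ x))
    ∈φ⇒∈φ-above {S} {x} x∉S x∈φS = fromInj₁
      (λ x∈low → contradiction refl (proj₂ (∈-comprehension⁻ low? x∈low)))
      (x∈p∪q⁻ T _ (φ-least (satisfies⇒closed base W W-satisfies) S⊆W x∈φS))
      where
      low? = atMostExcept? ρ x
      T = φ (S ∩ comprehension (above? ρ x))
      W = T ∪ comprehension low?

      W-satisfies : Satisfies Σ W
      W-satisfies = ∪-comprehension-satisfies low?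
        (premise-∉atMostExcept rank x)
        (λ B→c _ → satisfies⁻ Σ T (φ-satisfies base _) B→c)

      S⊆W : S ⊆ W
      S⊆W {y} y∈S with ρ x <? ρ y
      ... | yes x<y = x∈p∪q⁺ (inj₁ (extensive _
                        (x∈p∩q⁺ (y∈S , ∈-comprehension⁺ (above? ρ x) x<y))))
      ... | no  x≮y = x∈p∪q⁺ (inj₂ (∈-comprehension⁺ low?
                        (≮⇒≥ x≮y , λ { refl → x∉S y∈S })))

    minimalGenerator-above : ∀ {A b a} → IsMinimalGenerator A b → b ∉ A → a ∈ A → ρ b < ρ a
    minimalGenerator-above {A} {b} {a} (b∈φA , minimal) b∉A a∈A =
      decidable-stable (ρ b <? ρ a) λ b≮a →
        -- If `a` is not above `b`, then `A - a` keeps all elements of `A` above `b`, and these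
        -- already generate `b`.
        minimal a∈A (monotone (above⊆A-a b≮a) (∈φ⇒∈φ-above b∉A b∈φA))
      where
      above⊆A-a : ¬ ρ b < ρ a → A ∩ comprehension (above? ρ b) ⊆ A - a
      above⊆A-a b≮a y∈ with x∈p∩q⁻ A _ y∈
      ... | y∈A , y∈above = x∈p∧x≢y⇒x∈p-y y∈A
        λ { refl → b≮a (∈-comprehension⁻ (above? ρ b) y∈above) }

    -- With nothing of `S` above `x`, `∈φ⇒∈φ-above` would put `x` into the closure of the empty set.
    ∉φ-of-rank-≤ : φ ⊥ ≡ ⊥ → ∀ {S x} → x ∉ S → (∀ {y} → y ∈ S → ρ y ≤ ρ x) → x ∉ φ S
    ∉φ-of-rank-≤ ∅-closed {S} {x} x∉S S≤x x∈φS =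
      ∉⊥ (φ-least ∅-closed above⊆⊥ (∈φ⇒∈φ-above x∉S x∈φS))
      where
      above⊆⊥ : S ∩ comprehension (above? ρ x) ⊆ ⊥
      above⊆⊥ y∈ with x∈p∩q⁻ S _ y∈
      ... | y∈S , y∈above = contradiction
        (<-≤-trans (∈-comprehension⁻ (above? ρ x) y∈above) (S≤x y∈S)) (<-irrefl refl)

    module _ (∅-closed : φ ⊥ ≡ ⊥) {C : Implications n} (critical : IsCriticalBase X C) where
      open IsCriticalBase critical

      critical-above : ∀ {B c x} → (B , c) ∈ˡ C → x ∈ B → ρ c < ρ x
      critical-above B→c = minimalGenerator-above (minimalGenerators B→c)
                                                  (irredundant⇒b∉A irredundant B→c)

      critical-rank : IsRankFunction C ρ
      critical-rank {A} {a} {b} A→b a∈A = decidable-stable (ρ a ≟ⁿ ρ b + 1) λ a≢b+1 →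
        irredundant-essential irredundant A→b (redundant a≢b+1)
        where
        b<a : ρ b < ρ a
        b<a = critical-above A→b a∈A

        module _ (a≢b+1 : ρ a ≢ ρ b + 1) (S : Subset n) (sat : Satisfies (C ∖ (A , b)) S) where
          low?  = λ x → ρ x ≤? ρ b
          low'? = atMostExcept? ρ b
          -- V and W differ at most in b, so closedness of V settles every implication of Σ
          -- for W except those concluding b.
          V = S ∪ comprehension low?
          W = S ∪ comprehension low'?

          C-satisfies-above : ∀ {B c} → (B , c) ∈ˡ C → ¬ ρ c ≤ ρ b → B ⊆ S → c ∈ S
          C-satisfies-above B→c c≰b = satisfies⁻ (C ∖ (A , b)) S sat
            (∈-filter⁺ (λ j → ¬? (j ≟ⁱ (A , b))) B→c
              -- `A → b` is not among these implications, as `b` does not rank above itself.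
              λ { refl → c≰b ≤-refl })

          -- `b` is one of the added elements, so `V` satisfies `A → b` although `S` need not.
          V-closed : IsClosed V
          V-closed = satisfies⇒closed isBase V (∪-comprehension-satisfies low?
            (λ B→c c≰b x∈B x≤b →
              c≰b (<⇒≤ (<-≤-trans (critical-above B→c x∈B) x≤b)))
            C-satisfies-above)

          -- Since `φ A'` avoids `a`, `A → b` holds vacuously in `S ∩ φ A'`. This set thus satisfies
          -- all of `C`, so it is closed; it contains `A'`, hence `φ A'`, hence `b`.
          Σ-satisfies-b : ∀ {A'} → (A' , b) ∈ˡ Σ → A' ⊆ S → b ∈ S
          Σ-satisfies-b {A'} A'→b A'⊆S = p∩q⊆p S (φ A')
            (φ-least S∩φA'-closed (λ x∈A' → x∈p∩q⁺ (A'⊆S x∈A' , extensive _ x∈A'))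
              (satisfies⁻ Σ (φ A') (φ-satisfies base A') A'→b (extensive A')))
            where
            a∉φA' : a ∉ φ A'
            -- Members of `A'` have rank exactly `ρ b + 1`, so `a` is not one of them, and `b<a`
            -- says that this rank is at most `ρ a`.
            a∉φA' = ∉φ-of-rank-≤ ∅-closed (a≢b+1 ∘ rank A'→b) λ y∈A' →
              ≤-trans (≤-reflexive (trans (rank A'→b y∈A') (+-comm (ρ b) 1))) b<a

            S∩φA'-closed : IsClosed (S ∩ φ A')
            S∩φA'-closed = satisfies⇒closed isBase (S ∩ φ A') (∖-satisfies⁻ C (A , b) _
              (∩-satisfies (C ∖ (A , b)) S (φ A') sat
                (∖-satisfies C (A , b) _ (φ-satisfies isBase A')))
              (λ A⊆ → contradiction (p∩q⊆q S (φ A') (A⊆ a∈A)) a∉φA'))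

          Σ-satisfies : ∀ {B c} → (B , c) ∈ˡ Σ → ¬ AtMostExcept ρ b c → B ⊆ S → c ∈ S
          Σ-satisfies {B} {c} B→c ¬low B⊆S with c ≟ᶠ b
          ... | yes refl = Σ-satisfies-b B→c B⊆S
          -- Here `c` ranks above `b`, so it can only be in `V` by being in `S`.
          ... | no c≢b   = fromInj₁
            (λ c∈low → contradiction (∈-comprehension⁻ low? c∈low , c≢b) ¬low)
            (x∈p∪q⁻ S _ (satisfies⁻ Σ V (Equivalence.from (base V) V-closed) B→c
              (p⊆p∪q _ ∘ B⊆S)))

          W-closed : IsClosed W
          W-closed = satisfies⇒closed base W (∪-comprehension-satisfies low'?
            (premise-∉atMostExcept rank b) Σ-satisfies)

          redundant : A ⊆ S → b ∈ S
          -- `φ A` lies in `W`, whose low part omits `b`, so `b` must come from `S`.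
          redundant A⊆S = fromInj₁
            (λ b∈low → contradiction refl (proj₂ (∈-comprehension⁻ low'? b∈low)))
            (x∈p∪q⁻ S _ (φ-least W-closed (p⊆p∪q _ ∘ A⊆S) (proj₁ (minimalGenerators A→b))))

theorem2 : ∀ {n : ℕ} (X : ClosureSpace n) → IsAcyclicConvexGeometry X →
    ∀ (C : Implications n) → IsCriticalBase X C →
    IsRankedGeometry X ⇔ Ranked C
theorem2 X acyclic C critical = mk⇔
  (λ { (Σ , base , ρ , rank) → ρ , critical-rank X base rank ∅-closed critical })
  (λ ranked → C , IsCriticalBase.isBase critical , ranked)
  where
  open IsAcyclicConvexGeometry acyclic
  open ClosureSpace.IsStandard isStandard
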